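{- Let $\mathcal{C}$ be a category, let $\mathcal{M}$ be a class of morphisms of $\mathcal{C}$, and let $T$ be an object of $\mathcal{C}$. Let $\mathcal{M}/T$ be the category whose objects are pairs $(S,s)$ with $s : S \to T$ in $\mathcal{M}$ and whose morphisms $f:(S,s)\to(S',s')$ are morphisms $f:S\to S'$ of $\mathcal{C}$ with $s'\circ f = s$. Define $T_{\mathcal{M}} : \mathcal{M}/T \to \mathcal{C}$ by $T_{\mathcal{M}}(S,s) = S$, $T_{\mathcal{M}}f = f$, and $\tau_{(S,s)} = s$. Then $(\mathcal{M}/T, T_{\mathcal{M}}, \tau)$ is an $\mathcal{M}$-grading of $T$, and it is a pseudoterminal object of the 2-category $\mathrm{Grade}_{\mathcal{M}}(T)$. Explicitly, for every $\mathcal{M}$-grading $(\mathcal{G},G,g)$ of $T$: (i) there exists a morphism of $\mathcal{M}$-gradings $(F,f) : (\mathcal{G},G,g) \to (\mathcal{M}/T, T_{\mathcal{M}}, \tau)$; and (ii) this morphism is essentially unique, in the sense that there is an assignment, natural in $(F',f')$, of an invertible 2-cell $(F',f') \cong (F,f)$ to every morphism of $\mathcal{M}$-gradings $(F',f') : (\mathcal{G},G,g) \to (\mathcal{M}/T, T_{\mathcal{M}}, \tau)$.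
   Context: An $\mathcal{M}$-grading $(\mathcal{G},G,g)$ of an object $T$ of $\mathcal{C}$ consists of a category $\mathcal{G}$, a functor $G:\mathcal{G}\to\mathcal{C}$, and a natural transformation with components $g_d : Gd \to T$ (i.e. a cocone from $G$ to $T$) all of which lie in $\mathcal{M}$. A morphism $(F,f):(\mathcal{G},G,g)\to(\mathcal{G}',G',g')$ is a functor $F:\mathcal{G}\to\mathcal{G}'$ together with a natural isomorphism $f : G'\cdot F \cong G$ such that $g_d\circ f_d = g'_{Fd}$ for all $d$. A 2-cell $\beta:(F,f)\Rightarrow(F',f')$ is a natural transformation $\beta:F\Rightarrow F'$ with $f'\circ(G'\cdot\beta) = f$. These data form the 2-category $\mathrm{Grade}_{\mathcal{M}}(T)$. -}

module Defs where

open import Level using (Level; _⊔_; suc)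
open import Data.Product using (_×_; _,_)
open import Relation.Binary using (Rel; IsEquivalence; Setoid; _Respects_)
open import Relation.Unary using (Pred)
import Relation.Binary.Reasoning.Setoid as SetoidReasoning

-- Hom-sets are setoids, as usual for category theory without quotients;
-- there is no equality on objects.

record Category (o ℓ e : Level) : Set (suc (o ⊔ ℓ ⊔ e)) where
  infix  4 _≈_ _⇒_
  infixr 9 _∘_
  field
    Obj       : Set o
    _⇒_       : Obj → Obj → Set ℓ
    _≈_       : ∀ {A B} → Rel (A ⇒ B) e
    id        : ∀ {A} → A ⇒ A
    _∘_       : ∀ {A B C} → B ⇒ C → A ⇒ B → A ⇒ C
    equiv     : ∀ {A B} → IsEquivalence (_≈_ {A} {B})
    ∘-resp-≈  : ∀ {A B C} {f h : B ⇒ C} {g i : A ⇒ B} → f ≈ h → g ≈ i → f ∘ g ≈ h ∘ i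
    assoc     : ∀ {A B C D} {f : A ⇒ B} {g : B ⇒ C} {h : C ⇒ D} → (h ∘ g) ∘ f ≈ h ∘ (g ∘ f)
    identityˡ : ∀ {A B} {f : A ⇒ B} → id ∘ f ≈ f
    identityʳ : ∀ {A B} {f : A ⇒ B} → f ∘ id ≈ f

  module Equiv {A B} = IsEquivalence (equiv {A} {B})

  homSetoid : Obj → Obj → Setoid ℓ e
  homSetoid A B = record { Carrier = A ⇒ B ; _≈_ = _≈_ ; isEquivalence = equiv }

  module HomReasoning {A B} = SetoidReasoning (homSetoid A B)

  ∘-congˡ : ∀ {A B C} {f : B ⇒ C} {g i : A ⇒ B} → g ≈ i → f ∘ g ≈ f ∘ i
  ∘-congˡ = ∘-resp-≈ Equiv.refl

  ∘-congʳ : ∀ {A B C} {f h : B ⇒ C} {g : A ⇒ B} → f ≈ h → f ∘ g ≈ h ∘ g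
  ∘-congʳ p = ∘-resp-≈ p Equiv.refl

  id-comm : ∀ {A B} {f : A ⇒ B} → id ∘ f ≈ f ∘ id
  id-comm = Equiv.trans identityˡ (Equiv.sym identityʳ)

  infix 4 _≅_
  record _≅_ (A B : Obj) : Set (ℓ ⊔ e) where
    field
      to   : A ⇒ B
      from : B ⇒ A
      isoˡ : from ∘ to ≈ id
      isoʳ : to ∘ from ≈ id

private
  variable
    o ℓ e o₁ ℓ₁ e₁ o₂ ℓ₂ e₂ o₃ ℓ₃ e₃ m : Level

record Functor (C : Category o ℓ e) (D : Category o₁ ℓ₁ e₁) : Set (o ⊔ ℓ ⊔ e ⊔ o₁ ⊔ ℓ₁ ⊔ e₁) where
  private
    module C = Category C
    module D = Category D
  field
    F₀       : C.Obj → D.Obj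
    F₁       : ∀ {A B} → A C.⇒ B → F₀ A D.⇒ F₀ B
    resp-≈   : ∀ {A B} {f g : A C.⇒ B} → f C.≈ g → F₁ f D.≈ F₁ g
    identity : ∀ {A} → F₁ (C.id {A}) D.≈ D.id
    homo     : ∀ {X Y Z} {f : X C.⇒ Y} {g : Y C.⇒ Z} → F₁ (g C.∘ f) D.≈ F₁ g D.∘ F₁ f

idF : {C : Category o ℓ e} → Functor C C
idF {C = C} = record
  { F₀ = λ A → A ; F₁ = λ f → f ; resp-≈ = λ p → p ; identity = C.Equiv.refl ; homo = C.Equiv.refl }
  where module C = Category C

infixr 9 _∘F_
_∘F_ : {C : Category o ℓ e} {D : Category o₁ ℓ₁ e₁} {E : Category o₂ ℓ₂ e₂} →
       Functor D E → Functor C D → Functor C E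
_∘F_ {E = E} G F = record
  { F₀       = λ A → G.F₀ (F.F₀ A)
  ; F₁       = λ f → G.F₁ (F.F₁ f)
  ; resp-≈   = λ p → G.resp-≈ (F.resp-≈ p)
  ; identity = E.Equiv.trans (G.resp-≈ F.identity) G.identity
  ; homo     = E.Equiv.trans (G.resp-≈ F.homo) G.homo
  }
  where
    module E = Category E
    module G = Functor G
    module F = Functor F

module _ {C : Category o ℓ e} {D : Category o₁ ℓ₁ e₁} where
  private
    module C = Category C
    module D = Category D

  record NaturalTransformation (F G : Functor C D) : Set (o ⊔ ℓ ⊔ ℓ₁ ⊔ e₁) where
    private
      module F = Functor F
      module G = Functor G
    field
      η       : ∀ X → F.F₀ X D.⇒ G.F₀ X
      commute : ∀ {X Y} (f : X C.⇒ Y) → η Y D.∘ F.F₁ f D.≈ G.F₁ f D.∘ η X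

  open NaturalTransformation

  idN : {F : Functor C D} → NaturalTransformation F F
  idN = record { η = λ _ → D.id ; commute = λ _ → D.id-comm }

  infixr 9 _∘ᵥ_
  _∘ᵥ_ : {F G H : Functor C D} →
         NaturalTransformation G H → NaturalTransformation F G → NaturalTransformation F H
  _∘ᵥ_ {F} {G} {H} β α = record
    { η       = λ X → η β X D.∘ η α X
    ; commute = λ {X} {Y} f → begin
        (η β Y D.∘ η α Y) D.∘ Functor.F₁ F f  ≈⟨ D.assoc ⟩
        η β Y D.∘ η α Y D.∘ Functor.F₁ F f    ≈⟨ D.∘-congˡ (commute α f) ⟩
        η β Y D.∘ Functor.F₁ G f D.∘ η α X    ≈⟨ D.assoc ⟨
        (η β Y D.∘ Functor.F₁ G f) D.∘ η α X  ≈⟨ D.∘-congʳ (commute β f) ⟩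
        (Functor.F₁ H f D.∘ η β X) D.∘ η α X  ≈⟨ D.assoc ⟩
        Functor.F₁ H f D.∘ η β X D.∘ η α X    ∎
    }
    where open D.HomReasoning

Functors : Category o ℓ e → Category o₁ ℓ₁ e₁ →
           Category (o ⊔ ℓ ⊔ e ⊔ o₁ ⊔ ℓ₁ ⊔ e₁) (o ⊔ ℓ ⊔ ℓ₁ ⊔ e₁) (o ⊔ e₁)
Functors C D = record
  { Obj       = Functor C D
  ; _⇒_       = NaturalTransformation
  ; _≈_       = λ α β → ∀ X → η α X D.≈ η β X
  ; id        = idN
  ; _∘_       = _∘ᵥ_
  ; equiv     = record
    { refl  = λ _ → D.Equiv.refl
    ; sym   = λ p X → D.Equiv.sym (p X)
    ; trans = λ p q X → D.Equiv.trans (p X) (q X)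
    }
  ; ∘-resp-≈  = λ p q X → D.∘-resp-≈ (p X) (q X)
  ; assoc     = λ _ → D.assoc
  ; identityˡ = λ _ → D.identityˡ
  ; identityʳ = λ _ → D.identityʳ
  }
  where
    module D = Category D
    open NaturalTransformation

NaturalIsomorphism : {C : Category o ℓ e} {D : Category o₁ ℓ₁ e₁} →
                     Functor C D → Functor C D → Set (o ⊔ ℓ ⊔ ℓ₁ ⊔ e₁)
NaturalIsomorphism {C = C} {D = D} F G = F ≅ G
  where open Category (Functors C D)

Product : Category o ℓ e → Category o₁ ℓ₁ e₁ → Category (o ⊔ o₁) (ℓ ⊔ ℓ₁) (e ⊔ e₁)
Product C D = record
  { Obj       = C.Obj × D.Obj
  ; _⇒_       = λ (A , A′) (B , B′) → (A C.⇒ B) × (A′ D.⇒ B′)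
  ; _≈_       = λ (f , f′) (g , g′) → (f C.≈ g) × (f′ D.≈ g′)
  ; id        = C.id , D.id
  ; _∘_       = λ (g , g′) (f , f′) → g C.∘ f , g′ D.∘ f′
  ; equiv     = record
    { refl  = C.Equiv.refl , D.Equiv.refl
    ; sym   = λ (p , p′) → C.Equiv.sym p , D.Equiv.sym p′
    ; trans = λ (p , p′) (q , q′) → C.Equiv.trans p q , D.Equiv.trans p′ q′
    }
  ; ∘-resp-≈  = λ (p , p′) (q , q′) → C.∘-resp-≈ p q , D.∘-resp-≈ p′ q′
  ; assoc     = C.assoc , D.assoc
  ; identityˡ = C.identityˡ , D.identityˡ
  ; identityʳ = C.identityʳ , D.identityʳ
  }
  where
    module C = Category C
    module D = Category D

-- Since the laws of a functor are proof-relevant, composition of functors is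
-- associative and unital only up to natural isomorphisms with identity
-- components, not up to _≡_.  2-categories are therefore presented with
-- explicit coherence cells.

record Bicategory (o ℓ e t : Level) : Set (suc (o ⊔ ℓ ⊔ e ⊔ t)) where
  field
    Obj : Set t
    Hom : Obj → Obj → Category o ℓ e

  module Hom {A B} = Category (Hom A B)

  infix 4 _⇒₁_
  _⇒₁_ : Obj → Obj → Set o
  A ⇒₁ B = Category.Obj (Hom A B)

  id₂ : ∀ {A B} (f : A ⇒₁ B) → f Hom.⇒ f
  id₂ _ = Hom.id

  field
    id₁  : ∀ {A} → A ⇒₁ A
    comp : ∀ {A B C} → Functor (Product (Hom B C) (Hom A B)) (Hom A C)

  infixr 9 _⊚₀_ _⊚₁_
  _⊚₀_ : ∀ {A B C} → B ⇒₁ C → A ⇒₁ B → A ⇒₁ C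
  g ⊚₀ f = Functor.F₀ comp (g , f)

  _⊚₁_ : ∀ {A B C} {g g′ : B ⇒₁ C} {f f′ : A ⇒₁ B} →
         g Hom.⇒ g′ → f Hom.⇒ f′ → (g ⊚₀ f) Hom.⇒ (g′ ⊚₀ f′)
  β ⊚₁ α = Functor.F₁ comp (β , α)

  field
    unitˡ      : ∀ {A B} (f : A ⇒₁ B) → (id₁ ⊚₀ f) Hom.≅ f
    unitʳ      : ∀ {A B} (f : A ⇒₁ B) → (f ⊚₀ id₁) Hom.≅ f
    associator : ∀ {A B C D} (h : C ⇒₁ D) (g : B ⇒₁ C) (f : A ⇒₁ B) →
                 ((h ⊚₀ g) ⊚₀ f) Hom.≅ (h ⊚₀ (g ⊚₀ f))

  λ⇒ : ∀ {A B} (f : A ⇒₁ B) → (id₁ ⊚₀ f) Hom.⇒ f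
  λ⇒ f = Hom._≅_.to (unitˡ f)

  ρ⇒ : ∀ {A B} (f : A ⇒₁ B) → (f ⊚₀ id₁) Hom.⇒ f
  ρ⇒ f = Hom._≅_.to (unitʳ f)

  α⇒ : ∀ {A B C D} (h : C ⇒₁ D) (g : B ⇒₁ C) (f : A ⇒₁ B) →
       ((h ⊚₀ g) ⊚₀ f) Hom.⇒ (h ⊚₀ (g ⊚₀ f))
  α⇒ h g f = Hom._≅_.to (associator h g f)

  field
    unitˡ-natural : ∀ {A B} {f f′ : A ⇒₁ B} (β : f Hom.⇒ f′) →
                    λ⇒ f′ Hom.∘ (id₂ id₁ ⊚₁ β) Hom.≈ β Hom.∘ λ⇒ f
    unitʳ-natural : ∀ {A B} {f f′ : A ⇒₁ B} (β : f Hom.⇒ f′) →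
                    ρ⇒ f′ Hom.∘ (β ⊚₁ id₂ id₁) Hom.≈ β Hom.∘ ρ⇒ f
    associator-natural :
      ∀ {A B C D} {h h′ : C ⇒₁ D} {g g′ : B ⇒₁ C} {f f′ : A ⇒₁ B}
      (γ : h Hom.⇒ h′) (β : g Hom.⇒ g′) (α : f Hom.⇒ f′) →
      α⇒ h′ g′ f′ Hom.∘ ((γ ⊚₁ β) ⊚₁ α) Hom.≈ (γ ⊚₁ (β ⊚₁ α)) Hom.∘ α⇒ h g f
    triangle : ∀ {A B C} (g : B ⇒₁ C) (f : A ⇒₁ B) →
               (id₂ g ⊚₁ λ⇒ f) Hom.∘ α⇒ g id₁ f Hom.≈ ρ⇒ g ⊚₁ id₂ f
    pentagon : ∀ {A B C D E} (k : D ⇒₁ E) (h : C ⇒₁ D) (g : B ⇒₁ C) (f : A ⇒₁ B) →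
               (id₂ k ⊚₁ α⇒ h g f) Hom.∘ α⇒ k (h ⊚₀ g) f Hom.∘ (α⇒ k h g ⊚₁ id₂ f)
               Hom.≈ α⇒ k h (g ⊚₀ f) Hom.∘ α⇒ (k ⊚₀ h) g f

-- D is equivalent to the terminal category: id is isomorphic to a constant functor.

record EssentiallyUnique (D : Category o ℓ e) : Set (o ⊔ ℓ ⊔ e) where
  open Category D
  field
    centre  : Obj
    iso     : ∀ X → X ≅ centre
    natural : ∀ {X Y} (f : X ⇒ Y) → _≅_.to (iso Y) ∘ f ≈ _≅_.to (iso X)

IsPseudoterminal : ∀ {t} (B : Bicategory o ℓ e t) → Bicategory.Obj B → Set (o ⊔ ℓ ⊔ e ⊔ t)
IsPseudoterminal B T = ∀ X → EssentiallyUnique (Bicategory.Hom B X T)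

-- A predicate on morphisms is a class of morphisms only if it respects the
-- equality of each hom-setoid.

record MorphismClass (C : Category o ℓ e) (m : Level) : Set (o ⊔ ℓ ⊔ e ⊔ suc m) where
  open Category C
  field
    Member : ∀ {A B} → Pred (A ⇒ B) m
    resp   : ∀ {A B} → Member {A} {B} Respects _≈_

module _ {C : Category o ℓ e} (M : MorphismClass C m) (T : Category.Obj C) where
  private
    module C = Category C
    module M = MorphismClass M
  open NaturalTransformation
  open Category using (module _≅_)

  record IsGrading (𝒢 : Category o₁ ℓ₁ e₁) (G : Functor 𝒢 C)
                   (g : ∀ d → Functor.F₀ G d C.⇒ T) : Set (o₁ ⊔ ℓ₁ ⊔ e ⊔ m) where
    private module 𝒢 = Category 𝒢
    field
      cocone : ∀ {d d′} (u : d 𝒢.⇒ d′) → g d′ C.∘ Functor.F₁ G u C.≈ g d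
      member : ∀ d → M.Member (g d)

  record Grading (o₁ ℓ₁ e₁ : Level) : Set (o ⊔ ℓ ⊔ e ⊔ m ⊔ suc (o₁ ⊔ ℓ₁ ⊔ e₁)) where
    constructor grading
    field
      cat       : Category o₁ ℓ₁ e₁
      functor   : Functor cat C
      g         : ∀ d → Functor.F₀ functor d C.⇒ T
      isGrading : IsGrading cat functor g
    open Category cat public using (Obj)
    open Functor functor public
    open IsGrading isGrading public

  -- The gradings may live at different universe levels, so that gradings of
  -- any size can be compared with M/T.

  record GradingMorphism (X : Grading o₁ ℓ₁ e₁) (Y : Grading o₂ ℓ₂ e₂) :
         Set (o ⊔ ℓ ⊔ e ⊔ o₁ ⊔ ℓ₁ ⊔ e₁ ⊔ o₂ ⊔ ℓ₂ ⊔ e₂) where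
    private
      module X = Grading X
      module Y = Grading Y
    field
      F : Functor X.cat Y.cat
      f : NaturalIsomorphism (Y.functor ∘F F) X.functor
    open Functor F public

    f⇒ : ∀ d → Y.F₀ (F₀ d) C.⇒ X.F₀ d
    f⇒ = η (_≅_.to f)

    f⇐ : ∀ d → X.F₀ d C.⇒ Y.F₀ (F₀ d)
    f⇐ = η (_≅_.from f)

    field
      over : ∀ d → X.g d C.∘ f⇒ d C.≈ Y.g (F₀ d)

  record Grading2Cell {X : Grading o₁ ℓ₁ e₁} {Y : Grading o₂ ℓ₂ e₂} (K L : GradingMorphism X Y) :
         Set (o ⊔ ℓ ⊔ e ⊔ o₁ ⊔ ℓ₁ ⊔ e₁ ⊔ o₂ ⊔ ℓ₂ ⊔ e₂) where
    private
      module X = Grading X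
      module Y = Grading Y
      module K = GradingMorphism K
      module L = GradingMorphism L
    field
      β    : NaturalTransformation K.F L.F
      over : ∀ d → L.f⇒ d C.∘ Y.F₁ (η β d) C.≈ K.f⇒ d

  open Grading2Cell

  GradeHom : Grading o₁ ℓ₁ e₁ → Grading o₂ ℓ₂ e₂ →
             Category (o ⊔ ℓ ⊔ e ⊔ o₁ ⊔ ℓ₁ ⊔ e₁ ⊔ o₂ ⊔ ℓ₂ ⊔ e₂)
                      (o ⊔ ℓ ⊔ e ⊔ o₁ ⊔ ℓ₁ ⊔ e₁ ⊔ o₂ ⊔ ℓ₂ ⊔ e₂) (o₁ ⊔ e₂)
  GradeHom X Y = record
    { Obj       = GradingMorphism X Y
    ; _⇒_       = Grading2Cell
    ; _≈_       = λ σ ρ → β σ ≈ β ρ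
    ; id        = record
      { β = idN ; over = λ d → C.Equiv.trans (C.∘-congˡ Y.identity) C.identityʳ }
    ; _∘_       = λ {K} {L} {N} σ ρ → record
      { β    = β σ ∘ᵥ β ρ
      ; over = λ d → let open C.HomReasoning in begin
          f⇒ N d C.∘ Y.F₁ (η (β σ) d Y.∘ η (β ρ) d)           ≈⟨ C.∘-congˡ Y.homo ⟩
          f⇒ N d C.∘ Y.F₁ (η (β σ) d) C.∘ Y.F₁ (η (β ρ) d)    ≈⟨ C.assoc ⟨
          (f⇒ N d C.∘ Y.F₁ (η (β σ) d)) C.∘ Y.F₁ (η (β ρ) d)  ≈⟨ C.∘-congʳ (over σ d) ⟩
          f⇒ L d C.∘ Y.F₁ (η (β ρ) d)                         ≈⟨ over ρ d ⟩
          f⇒ K d                                              ∎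
      }
    ; equiv     = record
      { refl  = λ _ → Y.Equiv.refl
      ; sym   = λ p d → Y.Equiv.sym (p d)
      ; trans = λ p q d → Y.Equiv.trans (p d) (q d)
      }
    ; ∘-resp-≈  = λ p q d → Y.∘-resp-≈ (p d) (q d)
    ; assoc     = λ _ → Y.assoc
    ; identityˡ = λ _ → Y.identityˡ
    ; identityʳ = λ _ → Y.identityʳ
    }
    where
      module Y where
        open Category (Grading.cat Y) public
        open Grading Y public using (F₁; identity; homo)
      open Category (Functors (Grading.cat X) (Grading.cat Y)) using (_≈_)
      open GradingMorphism using (f⇒)

  idGrading : {X : Grading o₁ ℓ₁ e₁} → GradingMorphism X X
  idGrading {X = X} = record
    { F    = idF
    ; f    = record
      { to   = record { η = λ _ → C.id ; commute = λ _ → C.id-comm }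
      ; from = record { η = λ _ → C.id ; commute = λ _ → C.id-comm }
      ; isoˡ = λ _ → C.identityˡ
      ; isoʳ = λ _ → C.identityˡ
      }
    ; over = λ _ → C.identityʳ
    }

  -- (H , h) ∘G (F , f) = (H ∘F F , f ∘ hF).

  infixr 9 _∘G_
  _∘G_ : {X : Grading o₁ ℓ₁ e₁} {Y : Grading o₂ ℓ₂ e₂} {Z : Grading o₃ ℓ₃ e₃} →
         GradingMorphism Y Z → GradingMorphism X Y → GradingMorphism X Z
  _∘G_ {X = X} {Y} {Z} K L = record
    { F    = K.F ∘F L.F
    ; f    = record
      { to   = record
        { η       = λ d → L.f⇒ d C.∘ K.f⇒ (L.F₀ d)
        ; commute = λ u → paste (commute (_≅_.to L.f) u) (commute (_≅_.to K.f) (L.F₁ u))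
        }
      ; from = record
        { η       = λ d → K.f⇐ (L.F₀ d) C.∘ L.f⇐ d
        ; commute = λ u → paste (commute (_≅_.from K.f) (L.F₁ u)) (commute (_≅_.from L.f) u)
        }
      ; isoˡ = λ d → cancel (_≅_.isoˡ L.f d) (_≅_.isoˡ K.f (L.F₀ d))
      ; isoʳ = λ d → cancel (_≅_.isoʳ K.f (L.F₀ d)) (_≅_.isoʳ L.f d)
      }
    ; over = λ d → begin
        Grading.g X d C.∘ L.f⇒ d C.∘ K.f⇒ (L.F₀ d)    ≈⟨ C.assoc ⟨
        (Grading.g X d C.∘ L.f⇒ d) C.∘ K.f⇒ (L.F₀ d)  ≈⟨ C.∘-congʳ (L.over d) ⟩
        Grading.g Y (L.F₀ d) C.∘ K.f⇒ (L.F₀ d)        ≈⟨ K.over (L.F₀ d) ⟩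
        Grading.g Z (K.F₀ (L.F₀ d))                   ∎
    }
    where
      module K = GradingMorphism K
      module L = GradingMorphism L
      open C.HomReasoning

      paste : ∀ {A B P Q R S} {p : A C.⇒ B} {q : P C.⇒ Q} {r : R C.⇒ S}
              {a : P C.⇒ R} {b : Q C.⇒ S} {c : A C.⇒ P} {d : B C.⇒ Q} →
              b C.∘ q C.≈ r C.∘ a → d C.∘ p C.≈ q C.∘ c →
              (b C.∘ d) C.∘ p C.≈ r C.∘ (a C.∘ c)
      paste {p = p} {q} {r} {a} {b} {c} {d} s t = begin
        (b C.∘ d) C.∘ p  ≈⟨ C.assoc ⟩
        b C.∘ d C.∘ p    ≈⟨ C.∘-congˡ t ⟩
        b C.∘ q C.∘ c    ≈⟨ C.assoc ⟨
        (b C.∘ q) C.∘ c  ≈⟨ C.∘-congʳ s ⟩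
        (r C.∘ a) C.∘ c  ≈⟨ C.assoc ⟩
        r C.∘ a C.∘ c    ∎

      cancel : ∀ {A B P} {a : A C.⇒ B} {b : B C.⇒ A} {c : P C.⇒ A} {d : A C.⇒ P} →
               b C.∘ a C.≈ C.id → d C.∘ c C.≈ C.id → (d C.∘ b) C.∘ (a C.∘ c) C.≈ C.id
      cancel {a = a} {b} {c} {d} s t = begin
        (d C.∘ b) C.∘ (a C.∘ c)  ≈⟨ C.assoc ⟩
        d C.∘ b C.∘ a C.∘ c      ≈⟨ C.∘-congˡ C.assoc ⟨
        d C.∘ (b C.∘ a) C.∘ c    ≈⟨ C.∘-congˡ (C.∘-congʳ s) ⟩
        d C.∘ C.id C.∘ c         ≈⟨ C.∘-congˡ C.identityˡ ⟩
        d C.∘ c                  ≈⟨ t ⟩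
        C.id                     ∎

  infixr 9 _∘ₕ_
  _∘ₕ_ : {X : Grading o₁ ℓ₁ e₁} {Y : Grading o₂ ℓ₂ e₂} {Z : Grading o₃ ℓ₃ e₃}
         {K K′ : GradingMorphism Y Z} {L L′ : GradingMorphism X Y} →
         Grading2Cell K K′ → Grading2Cell L L′ → Grading2Cell (K ∘G L) (K′ ∘G L′)
  _∘ₕ_ {X = X} {Y} {Z} {K} {K′} {L} {L′} σ ρ = record
    { β    = record
      { η       = λ d → η (β σ) (L′.F₀ d) Z.∘ K.F₁ (η (β ρ) d)
      ; commute = λ {d} {d′} u → let open Z.HomReasoning in begin
          (η (β σ) (L′.F₀ d′) Z.∘ K.F₁ (η (β ρ) d′)) Z.∘ K.F₁ (L.F₁ u)
            ≈⟨ Z.assoc ⟩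
          η (β σ) (L′.F₀ d′) Z.∘ K.F₁ (η (β ρ) d′) Z.∘ K.F₁ (L.F₁ u)
            ≈⟨ Z.∘-congˡ K.homo ⟨
          η (β σ) (L′.F₀ d′) Z.∘ K.F₁ (η (β ρ) d′ Y.∘ L.F₁ u)
            ≈⟨ Z.∘-congˡ (K.resp-≈ (commute (β ρ) u)) ⟩
          η (β σ) (L′.F₀ d′) Z.∘ K.F₁ (L′.F₁ u Y.∘ η (β ρ) d)
            ≈⟨ Z.∘-congˡ K.homo ⟩
          η (β σ) (L′.F₀ d′) Z.∘ K.F₁ (L′.F₁ u) Z.∘ K.F₁ (η (β ρ) d)
            ≈⟨ Z.assoc ⟨
          (η (β σ) (L′.F₀ d′) Z.∘ K.F₁ (L′.F₁ u)) Z.∘ K.F₁ (η (β ρ) d)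
            ≈⟨ Z.∘-congʳ (commute (β σ) (L′.F₁ u)) ⟩
          (K′.F₁ (L′.F₁ u) Z.∘ η (β σ) (L′.F₀ d)) Z.∘ K.F₁ (η (β ρ) d)
            ≈⟨ Z.assoc ⟩
          K′.F₁ (L′.F₁ u) Z.∘ η (β σ) (L′.F₀ d) Z.∘ K.F₁ (η (β ρ) d) ∎
      }
    ; over = λ d → let open C.HomReasoning in begin
        (L′.f⇒ d C.∘ K′.f⇒ (L′.F₀ d)) C.∘ GZ.F₁ (η (β σ) (L′.F₀ d) Z.∘ K.F₁ (η (β ρ) d))
          ≈⟨ C.∘-congˡ GZ.homo ⟩
        (L′.f⇒ d C.∘ K′.f⇒ (L′.F₀ d)) C.∘ GZ.F₁ (η (β σ) (L′.F₀ d)) C.∘ GZ.F₁ (K.F₁ (η (β ρ) d))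
          ≈⟨ C.assoc ⟩
        L′.f⇒ d C.∘ K′.f⇒ (L′.F₀ d) C.∘ GZ.F₁ (η (β σ) (L′.F₀ d)) C.∘ GZ.F₁ (K.F₁ (η (β ρ) d))
          ≈⟨ C.∘-congˡ C.assoc ⟨
        L′.f⇒ d C.∘ (K′.f⇒ (L′.F₀ d) C.∘ GZ.F₁ (η (β σ) (L′.F₀ d))) C.∘ GZ.F₁ (K.F₁ (η (β ρ) d))
          ≈⟨ C.∘-congˡ (C.∘-congʳ (over σ (L′.F₀ d))) ⟩
        L′.f⇒ d C.∘ K.f⇒ (L′.F₀ d) C.∘ GZ.F₁ (K.F₁ (η (β ρ) d))
          ≈⟨ C.∘-congˡ (commute (_≅_.to K.f) (η (β ρ) d)) ⟩
        L′.f⇒ d C.∘ GY.F₁ (η (β ρ) d) C.∘ K.f⇒ (L.F₀ d)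
          ≈⟨ C.assoc ⟨
        (L′.f⇒ d C.∘ GY.F₁ (η (β ρ) d)) C.∘ K.f⇒ (L.F₀ d)
          ≈⟨ C.∘-congʳ (over ρ d) ⟩
        L.f⇒ d C.∘ K.f⇒ (L.F₀ d) ∎
    }
    where
      module Y = Category (Grading.cat Y)
      module Z = Category (Grading.cat Z)
      module GY = Grading Y
      module GZ = Grading Z
      module K = GradingMorphism K
      module K′ = GradingMorphism K′
      module L = GradingMorphism L
      module L′ = GradingMorphism L′

  compose : {X : Grading o₁ ℓ₁ e₁} {Y : Grading o₂ ℓ₂ e₂} {Z : Grading o₃ ℓ₃ e₃} →
            Functor (Product (GradeHom Y Z) (GradeHom X Y)) (GradeHom X Z)
  compose {X = X} {Y} {Z} = record
    { F₀       = λ (K , L) → K ∘G L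
    ; F₁       = λ (σ , ρ) → σ ∘ₕ ρ
    ; resp-≈   = λ { {K , _} {_ , L′} (p , q) d →
        Z.∘-resp-≈ (p (F₀ L′ d)) (resp-≈ K (q d)) }
    ; identity = λ { {K , _} d → Z.Equiv.trans Z.identityˡ (identity K) }
    ; homo     = λ { {K , L} {K′ , L′} {K″ , L″} {σ , ρ} {σ′ , ρ′} d →
        let open Z.HomReasoning
            s′ = η (β σ′) (F₀ L″ d)
            s  = η (β σ) (F₀ L″ d)
            r′ = η (β ρ′) d
            r  = η (β ρ) d
        in begin
          (s′ Z.∘ s) Z.∘ F₁ K (r′ Y.∘ r)         ≈⟨ Z.∘-congˡ (homo K) ⟩
          (s′ Z.∘ s) Z.∘ F₁ K r′ Z.∘ F₁ K r      ≈⟨ Z.assoc ⟩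
          s′ Z.∘ s Z.∘ F₁ K r′ Z.∘ F₁ K r        ≈⟨ Z.∘-congˡ Z.assoc ⟨
          s′ Z.∘ (s Z.∘ F₁ K r′) Z.∘ F₁ K r      ≈⟨ Z.∘-congˡ (Z.∘-congʳ (commute (β σ) r′)) ⟩
          s′ Z.∘ (F₁ K′ r′ Z.∘ η (β σ) (F₀ L′ d)) Z.∘ F₁ K r
                                                 ≈⟨ Z.∘-congˡ Z.assoc ⟩
          s′ Z.∘ F₁ K′ r′ Z.∘ η (β σ) (F₀ L′ d) Z.∘ F₁ K r
                                                 ≈⟨ Z.assoc ⟨
          (s′ Z.∘ F₁ K′ r′) Z.∘ η (β σ) (F₀ L′ d) Z.∘ F₁ K r ∎ }
    }
    where
      module Y = Category (Grading.cat Y)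
      module Z = Category (Grading.cat Z)
      open GradingMorphism using (F₀; F₁; resp-≈; identity; homo)

  GradeUnitˡ : {X : Grading o₁ ℓ₁ e₁} {Y : Grading o₂ ℓ₂ e₂} (K : GradingMorphism X Y) →
               let open Category (GradeHom X Y) in (idGrading ∘G K) ≅ K
  GradeUnitˡ {Y = Y} K = record
    { to   = record
      { β    = record { η = λ _ → Y.id ; commute = λ _ → Y.id-comm }
      ; over = λ _ → C.∘-congˡ (Grading.identity Y)
      }
    ; from = record
      { β    = record { η = λ _ → Y.id ; commute = λ _ → Y.id-comm }
      ; over = λ _ → C.Equiv.trans (C.∘-congʳ C.identityʳ)
                       (C.Equiv.trans (C.∘-congˡ (Grading.identity Y)) C.identityʳ)
      }
    ; isoˡ = λ _ → Y.identityˡ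
    ; isoʳ = λ _ → Y.identityˡ
    }
    where module Y = Category (Grading.cat Y)

  GradeUnitʳ : {X : Grading o₁ ℓ₁ e₁} {Y : Grading o₂ ℓ₂ e₂} (K : GradingMorphism X Y) →
               let open Category (GradeHom X Y) in (K ∘G idGrading) ≅ K
  GradeUnitʳ {Y = Y} K = record
    { to   = record
      { β    = record { η = λ _ → Y.id ; commute = λ _ → Y.id-comm }
      ; over = λ _ → C.Equiv.trans (C.∘-congˡ (Grading.identity Y))
                       (C.Equiv.trans C.identityʳ (C.Equiv.sym C.identityˡ))
      }
    ; from = record
      { β    = record { η = λ _ → Y.id ; commute = λ _ → Y.id-comm }
      ; over = λ _ → C.Equiv.trans (C.∘-congʳ C.identityˡ)
                       (C.Equiv.trans (C.∘-congˡ (Grading.identity Y)) C.identityʳ)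
      }
    ; isoˡ = λ _ → Y.identityˡ
    ; isoʳ = λ _ → Y.identityˡ
    }
    where module Y = Category (Grading.cat Y)

  GradeAssociator :
    ∀ {o₄ ℓ₄ e₄} {W : Grading o₄ ℓ₄ e₄} {X : Grading o₁ ℓ₁ e₁} {Y : Grading o₂ ℓ₂ e₂} {Z : Grading o₃ ℓ₃ e₃}
    (N : GradingMorphism Y Z) (K : GradingMorphism X Y) (L : GradingMorphism W X) →
    let open Category (GradeHom W Z) in ((N ∘G K) ∘G L) ≅ (N ∘G (K ∘G L))
  GradeAssociator {Z = Z} N K L = record
    { to   = record
      { β    = record { η = λ _ → Z.id ; commute = λ _ → Z.id-comm }
      ; over = λ _ → C.Equiv.trans (C.∘-congˡ (Grading.identity Z))
                       (C.Equiv.trans C.identityʳ C.assoc)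
      }
    ; from = record
      { β    = record { η = λ _ → Z.id ; commute = λ _ → Z.id-comm }
      ; over = λ _ → C.Equiv.trans (C.∘-congˡ (Grading.identity Z))
                       (C.Equiv.trans C.identityʳ (C.Equiv.sym C.assoc))
      }
    ; isoˡ = λ _ → Z.identityˡ
    ; isoʳ = λ _ → Z.identityˡ
    }
    where module Z = Category (Grading.cat Z)

  Grade : (o₁ ℓ₁ e₁ : Level) →
          Bicategory (o ⊔ ℓ ⊔ e ⊔ o₁ ⊔ ℓ₁ ⊔ e₁) (o ⊔ ℓ ⊔ e ⊔ o₁ ⊔ ℓ₁ ⊔ e₁) (o₁ ⊔ e₁)
                     (o ⊔ ℓ ⊔ e ⊔ m ⊔ suc (o₁ ⊔ ℓ₁ ⊔ e₁))
  Grade o₁ ℓ₁ e₁ = record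
    { Obj                = Grading o₁ ℓ₁ e₁
    ; Hom                = GradeHom
    ; id₁                = idGrading
    ; comp               = compose
    ; unitˡ              = GradeUnitˡ
    ; unitʳ              = GradeUnitʳ
    ; associator         = GradeAssociator
    ; unitˡ-natural      = λ { {B = Y} _ _ → let open Category (Grading.cat Y) in
        Equiv.trans identityˡ id-comm }
    ; unitʳ-natural      = λ { {B = Y} {f = K} _ _ → let open Category (Grading.cat Y) in
        Equiv.trans identityˡ (∘-congˡ (identity K)) }
    ; associator-natural = λ { {D = Z} {h = N} _ _ _ _ → let open Category (Grading.cat Z) in
        Equiv.trans identityˡ (Equiv.trans assoc
          (Equiv.trans (∘-congˡ (Equiv.sym (homo N))) (Equiv.sym identityʳ))) }
    ; triangle           = λ { {C = Z} _ _ _ → let open Category (Grading.cat Z) in identityʳ }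
    ; pentagon           = λ { {E = V} J N K _ _ → let open Category (Grading.cat V) in
        Equiv.trans (∘-congʳ (Equiv.trans identityˡ (identity J)))
          (∘-congˡ (Equiv.trans identityˡ (Equiv.trans identityˡ (identity (J ∘G (N ∘G K)))))) }
    }
    where open GradingMorphism using (identity; homo)

  -- Slice is the full subcategory M/T of the slice category C/T, and SliceForget
  -- is T_M.

  record SliceObj : Set (o ⊔ ℓ ⊔ m) where
    field
      S      : C.Obj
      s      : S C.⇒ T
      member : M.Member s

  open SliceObj

  record Slice⇒ (A B : SliceObj) : Set (ℓ ⊔ e) where
    field
      arr  : S A C.⇒ S B
      over : s B C.∘ arr C.≈ s A

  open Slice⇒

  Slice : Category (o ⊔ ℓ ⊔ m) (ℓ ⊔ e) e
  Slice = record
    { Obj       = SliceObj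
    ; _⇒_       = Slice⇒
    ; _≈_       = λ f g → arr f C.≈ arr g
    ; id        = record { arr = C.id ; over = C.identityʳ }
    ; _∘_       = λ g f → record
      { arr  = arr g C.∘ arr f
      ; over = C.Equiv.trans (C.Equiv.sym C.assoc) (C.Equiv.trans (C.∘-congʳ (over g)) (over f))
      }
    ; equiv     = record { refl = C.Equiv.refl ; sym = C.Equiv.sym ; trans = C.Equiv.trans }
    ; ∘-resp-≈  = C.∘-resp-≈
    ; assoc     = C.assoc
    ; identityˡ = C.identityˡ
    ; identityʳ = C.identityʳ
    }

  SliceForget : Functor Slice C
  SliceForget = record
    { F₀       = S
    ; F₁       = arr
    ; resp-≈   = λ p → p
    ; identity = C.Equiv.refl
    ; homo     = C.Equiv.refl
    }

  τ : ∀ A → S A C.⇒ T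
  τ = s

{-# OPTIONS --safe #-}

-- An object of M/T is exactly a leg of an M-graded cocone, so a grading
-- (𝒢, G, g) gives the functor d ↦ (G d, g d) lying strictly over T.  For any
-- other (F, f) into M/T, the condition g d ∘ f d ≈ τ (F d) says that f d is
-- itself a morphism of M/T, so f is the comparison 2-cell; its naturality in
-- (F, f) is the equation defining 2-cells.

module Submission where

open import Defs
open import Level using (Level; _⊔_)
open import Data.Product using (Σ-syntax; _×_; _,_)

module _ {o ℓ e m} {C : Category o ℓ e} (M : MorphismClass C m) (T : Category.Obj C) where
  private
    module C = Category C
  open NaturalTransformation
  open Category using (module _≅_)

  slice-isGrading : IsGrading M T (Slice M T) (SliceForget M T) (τ M T)
  slice-isGrading = record
    { cocone = Slice⇒.over
    ; member = SliceObj.member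
    }

  sliceGrading : Grading M T (o ⊔ ℓ ⊔ m) (ℓ ⊔ e) e
  sliceGrading = grading (Slice M T) (SliceForget M T) (τ M T) slice-isGrading

  module _ {o₁ ℓ₁ e₁} (X : Grading M T o₁ ℓ₁ e₁) where
    private
      module X = Grading X
    open Category (GradeHom M T X sliceGrading) using (_≅_)

    classify : GradingMorphism M T X sliceGrading
    classify = record
      { F    = record
        { F₀       = λ d → record { S = X.F₀ d ; s = X.g d ; member = X.member d }
        ; F₁       = λ u → record { arr = X.F₁ u ; over = X.cocone u }
        ; resp-≈   = X.resp-≈
        ; identity = X.identity
        ; homo     = X.homo
        }
      ; f    = record
        { to   = record { η = λ _ → C.id ; commute = λ _ → C.id-comm }
        ; from = record { η = λ _ → C.id ; commute = λ _ → C.id-comm }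
        ; isoˡ = λ _ → C.identityˡ
        ; isoʳ = λ _ → C.identityˡ
        }
      ; over = λ _ → C.identityʳ
      }

    -- Since `f⇒ d` lies over `T`, so does its inverse; this makes `f⇐ d` a morphism of `Slice`, as
    -- the inverse comparison cell requires.
    f⇐-over : ∀ (K : GradingMorphism M T X sliceGrading) d → let open GradingMorphism K in
              SliceObj.s (F₀ d) C.∘ f⇐ d C.≈ X.g d
    f⇐-over K d = begin
      SliceObj.s (F₀ d) C.∘ f⇐ d   ≈⟨ C.∘-congʳ (over d) ⟨
      (X.g d C.∘ f⇒ d) C.∘ f⇐ d    ≈⟨ C.assoc ⟩
      X.g d C.∘ f⇒ d C.∘ f⇐ d      ≈⟨ C.∘-congˡ (_≅_.isoʳ f d) ⟩
      X.g d C.∘ C.id               ≈⟨ C.identityʳ ⟩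
      X.g d                        ∎
      where
        open GradingMorphism K
        open C.HomReasoning

    comparison : ∀ K → K ≅ classify
    comparison K = record
      { to   = record
        { β    = record
          { η       = λ d → record { arr = f⇒ d ; over = over d }
          -- Morphisms of `Slice` are equal when their underlying arrows are, so naturality in `C`
          -- suffices.
          ; commute = commute (_≅_.to f)
          }
        ; over = λ _ → C.identityˡ
        }
      ; from = record
        { β    = record
          { η       = λ d → record { arr = f⇐ d ; over = f⇐-over K d }
          ; commute = commute (_≅_.from f)
          }
        -- `classify` has identity components, so the 2-cell equation into `K` reads
        -- `f⇒ d ∘ f⇐ d ≈ id`.
        ; over = _≅_.isoʳ f
        }
      ; isoˡ = _≅_.isoˡ f
      ; isoʳ = _≅_.isoʳ f
      }
      where open GradingMorphism K

    hom-essentiallyUnique : EssentiallyUnique (GradeHom M T X sliceGrading)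
    hom-essentiallyUnique = record
      { centre  = classify
      ; iso     = comparison
      ; natural = Grading2Cell.over
      }

theorem2p3 :
  ∀ {o ℓ e m o₁ ℓ₁ e₁ : Level}
    (C : Category o ℓ e) (M : MorphismClass C m) (T : Category.Obj C) →
  Σ[ isGr ∈ IsGrading M T (Slice M T) (SliceForget M T) (τ M T) ]
    (let M/T : Grading M T (o ⊔ ℓ ⊔ m) (ℓ ⊔ e) e
         M/T = grading (Slice M T) (SliceForget M T) (τ M T) isGr
     in IsPseudoterminal (Grade M T (o ⊔ ℓ ⊔ m) (ℓ ⊔ e) e) M/T
        × ((X : Grading M T o₁ ℓ₁ e₁) → EssentiallyUnique (GradeHom M T X M/T)))
theorem2p3 C M T =
  -- The same lemma serves twice: at the universe levels of the slice grading, where it is an object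
  -- of `Grade`, and at arbitrary levels of `X`.
  slice-isGrading M T , hom-essentiallyUnique M T , hom-essentiallyUnique M T
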